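{- Let $G$ be a finite simple subcubic graph, let $e=uv\in E(G)$, and suppose that $G-e$ is connected. For every even cover $F$ of $G$ containing $e$, the graph $G-e$ admits a walk from $u$ to $v$ visiting every vertex of $G$, of length at most $|V(G)|+\mathrm{exc}(F)-3$. Consequently, $$\mathrm{OPT}(G-e,u,v)\le |V(G)|+\mathrm{exc}_e(G)-1 .$$
   Context: A graph is subcubic if its maximum degree is at most $3$. An even cover of $G$ is a spanning subgraph $F$ of $G$ in which every vertex has degree $0$ or $2$ (so $F$ is a disjoint union of cycles and isolated vertices); its excess is $\mathrm{exc}(F)=2\cdot(\text{number of cycles of }F)+(\text{number of isolated vertices of }F)$. For an edge $e$, $\mathcal E(G,e)$ is the set of even covers of $G$ containing $e$, and $\mathrm{exc}_e(G):=\min_{F\in\mathcal E(G,e)}\mathrm{exc}(F)-2$. For a connected graph $H$ and distinct vertices $u,v$, $\mathrm{OPT}(H,u,v)$ is the length (number of edges, counted with repetition) of a shortest walk in $H$ from $u$ to $v$ visiting every vertex of $H$ (repetitions allowed). -}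

module Defs where

open import Data.Empty using (⊥)
open import Data.Fin using (Fin; _<_)
open import Data.Fin.Properties using (_≟_; _<?_)
open import Data.Integer as ℤ using (ℤ; +_)
open import Data.List using (List; []; _∷_; _∷ʳ_; length; filter; allFin; upTo; concatMap; cartesianProductWith)
open import Data.List.Membership.Propositional using (_∈_)
open import Data.List.NonEmpty as List⁺ using (_∷_)
open import Data.List.Relation.Unary.All as All using (All)
open import Data.List.Relation.Unary.Linked as Linked using (Linked)
open import Data.List.Relation.Unary.Unique.Propositional using (Unique)
open import Data.List.Relation.Unary.Unique.DecPropositional as UniqueDec using ()
open import Data.Nat as ℕ using (ℕ; suc; _+_; _*_; _≤_)
open import Data.Nat.Properties as ℕₚ using ()
open import Data.Product using (_×_; _,_; Σ-syntax; ∃-syntax; swap)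
open import Data.Sum using (_⊎_; inj₁; inj₂)
open import Function using (_∘_)
open import Level using (Level; 0ℓ)
open import Relation.Binary using (Rel; Symmetric; Irreflexive; Decidable)
open import Relation.Binary.Construct.Closure.ReflexiveTransitive using (Star; ε; _◅_)
open import Relation.Binary.PropositionalEquality using (_≡_)
open import Relation.Nullary using (¬_; no; _×-dec_; _⊎-dec_; ¬?)
import Relation.Unary as U

private
  variable
    n : ℕ
    ℓ : Level

record Graph (n : ℕ) : Set₁ where
  field
    _~_      : Rel (Fin n) 0ℓ
    ~-sym    : Symmetric _~_
    ~-irrefl : Irreflexive _≡_ _~_
    _~?_     : Decidable _~_

open Graph public using () renaming (_~_ to Adj; _~?_ to Adj?)

degree : Graph n → Fin n → ℕ
degree G x = length (filter (Adj? G x) (allFin _))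

Subcubic : Graph n → Set
Subcubic G = ∀ x → degree G x ≤ 3

SameEdge : (u v x y : Fin n) → Set
SameEdge u v x y = (x ≡ u × y ≡ v) ⊎ (x ≡ v × y ≡ u)

deleteEdge : Graph n → (u v : Fin n) → Graph n
deleteEdge G u v = record
  { _~_      = λ x y → Adj G x y × ¬ SameEdge u v x y
  ; ~-sym    = λ (x~y , ≠uv) → ~-sym x~y , ≠uv ∘ flipEdge
  ; ~-irrefl = λ x≡y (x~y , _) → ~-irrefl x≡y x~y
  ; _~?_     = λ x y → Adj? G x y ×-dec
                       ¬? ((x ≟ u ×-dec y ≟ v) ⊎-dec (x ≟ v ×-dec y ≟ u))
  }
  where
  open Graph G
  flipEdge : ∀ {x y} → SameEdge u v y x → SameEdge u v x y
  flipEdge (inj₁ p) = inj₂ (swap p)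
  flipEdge (inj₂ p) = inj₁ (swap p)

Walk : Graph n → Fin n → Fin n → Set
Walk G = Star (Adj G)

walkLength : {T : Rel (Fin n) 0ℓ} {x y : Fin n} → Star T x y → ℕ
walkLength ε       = 0
walkLength (_ ◅ w) = suc (walkLength w)

vertices : {T : Rel (Fin n) 0ℓ} {x y : Fin n} → Star T x y → List (Fin n)
vertices {x = x} ε       = x ∷ []
vertices {x = x} (_ ◅ w) = x ∷ vertices w

VisitsAll : {T : Rel (Fin n) 0ℓ} {x y : Fin n} → Star T x y → Set
VisitsAll w = ∀ z → z ∈ vertices w

Connected : Graph n → Set
Connected G = ∀ x y → Walk G x y

-- A cycle is given by a cyclic listing of its vertices.
IsCycle : Graph n → List (Fin n) → Set
IsCycle G []       = ⊥
IsCycle G (x ∷ ys) = 3 ≤ length (x ∷ ys) × Unique (x ∷ ys) × Linked (Adj G) (x ∷ ys ∷ʳ x)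

-- A cycle with k ≥ 3 vertices has 2k cyclic listings (a starting vertex and a
-- direction).  Exactly one of them is canonical: the one that starts at the
-- smallest vertex of the cycle and moves first to the smaller of the two
-- neighbours which that vertex has on the cycle.
Canonical : List (Fin n) → Set
Canonical []           = ⊥
Canonical (x ∷ [])     = ⊥
Canonical (x ∷ y ∷ zs) = All (x <_) (y ∷ zs) × y < List⁺.last (y ∷ zs)

isCycle? : (G : Graph n) → U.Decidable (IsCycle G)
isCycle? G []       = no λ ()
isCycle? G (x ∷ ys) =
  3 ℕₚ.≤? length (x ∷ ys) ×-dec UniqueDec.unique? _≟_ (x ∷ ys) ×-dec
  Linked.linked? (Adj? G) (x ∷ ys ∷ʳ x)

canonical? : U.Decidable (Canonical {n})
canonical? []           = no λ ()
canonical? (x ∷ [])     = no λ ()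
canonical? (x ∷ y ∷ zs) = All.all? (x <?_) (y ∷ zs) ×-dec y <? List⁺.last (y ∷ zs)

listsOfLength : ℕ → List (List (Fin n))
listsOfLength 0       = [] ∷ []
listsOfLength (suc k) = cartesianProductWith _∷_ (allFin _) (listsOfLength k)

-- One canonical listing for each cycle subgraph of G; length n suffices
-- because the vertices of a cycle are distinct.
cycles : Graph n → List (List (Fin n))
cycles {n} G = filter (λ c → isCycle? G c ×-dec canonical? c)
                      (concatMap listsOfLength (upTo (suc n)))

isolatedVertices : Graph n → List (Fin n)
isolatedVertices G = filter (λ x → degree G x ℕₚ.≟ 0) (allFin _)

exc : Graph n → ℕ
exc F = 2 * length (cycles F) + length (isolatedVertices F)

-- A spanning subgraph of G has the same vertex set Fin n.
record IsEvenCover (G F : Graph n) : Set where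
  field
    subgraph    : ∀ {x y} → Adj F x y → Adj G x y
    degree-even : ∀ x → degree F x ≡ 0 ⊎ degree F x ≡ 2

-- F belongs to 𝓔(G , uv).
IsEvenCoverThrough : Graph n → (u v : Fin n) → Graph n → Set
IsEvenCoverThrough G u v F = IsEvenCover G F × Adj F u v

IsMinimum : (ℕ → Set ℓ) → ℕ → Set ℓ
IsMinimum P m = P m × (∀ k → P k → m ≤ k)

-- x = exc_{uv}(G).
IsExcₑ : Graph n → (u v : Fin n) → ℤ → Set₁
IsExcₑ G u v x =
  ∃[ m ] IsMinimum (λ k → Σ[ F ∈ Graph _ ] (IsEvenCoverThrough G u v F × exc F ≡ k)) m
       × x ≡ + m ℤ.- + 2

-- o = OPT(H , u , v).
IsOPT : Graph n → (u v : Fin n) → ℕ → Set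
IsOPT H u v =
  IsMinimum (λ k → Σ[ w ∈ Walk H u v ] (VisitsAll w × walkLength w ≡ k))

{-# OPTIONS --safe #-}
-- Removing e from the cycle C of F through e leaves a path from u to v of length
-- |C| - 1.  As G - e is connected, some edge xy of it leaves the visited set as long as
-- that set, a union of components of F, is not everything; a detour along xy, around
-- the component of y and back costs 2 for an isolated vertex and |C'| + 2 for a cycle
-- C'.  With k cycles and i isolated vertices the total is n - i - 1 + 2(k - 1) + 2i =
-- n + exc(F) - 3.
module Submission where

open import Defs
open import Data.Nat using (ℕ)
open import Data.Fin using (Fin)
open import Data.Integer using (ℤ; +_; _+_; _-_; _≤_)
open import Data.Product using (_×_; Σ-syntax; ∃-syntax)

open import Data.Fin as Fin using ()
open import Data.Fin.Induction using (<-wellFounded)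
open import Data.Fin.Properties as Finₚ using (any?; _≟_; _<?_)
open import Data.Integer as ℤ using ()
open import Data.Integer.Properties as ℤₚ using ()
open import Data.Integer.Tactic.RingSolver using () renaming (solve-∀ to ℤ-solve-∀)
open import Data.List using (List; []; _∷_; [_]; _∷ʳ_; _++_; length; filter; allFin; initLast; _∷ʳ′_)
open import Data.List.Membership.DecPropositional using (_∈?_)
open import Data.List.Membership.Propositional using (_∈_; _∉_; find; lose)
open import Data.List.Membership.Propositional.Properties
  using (∈-∃++; ∈-++⁺ˡ; ∈-++⁺ʳ; ∈-++⁻; ∈-filter⁺; ∈-filter⁻; ∈-allFin; ∈-upTo⁺;
         ∈-concatMap⁺; ∈-cartesianProductWith⁺)
open import Data.List.NonEmpty using (_∷_; last)
open import Data.List.Properties using (length-++; length-tabulate)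
open import Data.List.Relation.Binary.Subset.Propositional using (_⊆_)
open import Data.List.Relation.Unary.All as All using (All; []; _∷_; all?)
open import Data.List.Relation.Unary.All.Properties using (¬Any⇒All¬; All¬⇒¬Any; ¬All⇒Any¬)
open import Data.List.Relation.Unary.AllPairs as AllPairs using ()
open import Data.List.Relation.Unary.Any using (here; there)
open import Data.List.Relation.Unary.Linked using (Linked; []; [-]; _∷_)
open import Data.List.Relation.Unary.Unique.Propositional using (Unique; []; _∷_)
open import Data.List.Relation.Unary.Unique.Propositional.Properties using (allFin⁺; filter⁺; ++⁺)
open import Data.Nat as ℕ using (suc; zero; z≤n; s≤s)
open import Data.Nat.Induction using () renaming (<-wellFounded to ℕ-<-wellFounded)
open import Induction.WellFounded using (Acc; acc)
open import Data.Nat.Properties as ℕₚ using ()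
open import Data.Nat.Tactic.RingSolver using (solve-∀)
open import Data.Product using (_,_; proj₁; proj₂; map₂)
open import Data.Sum using (_⊎_; inj₁; inj₂; [_,_]′)
open import Function using (_∘_)
open import Level using (0ℓ)
open import Relation.Binary using (Rel; tri<; tri≈; tri>)
open import Relation.Binary.Construct.Closure.ReflexiveTransitive using (Star; ε; _◅_; _◅◅_)
open import Relation.Binary.PropositionalEquality
  using (_≡_; _≢_; refl; sym; trans; cong; subst; ≢-sym)
open import Relation.Nullary using (¬_; Dec; yes; no; contradiction; _×-dec_)
import Relation.Unary as U

private
  variable
    A : Set
    n : ℕ

-- Counting with duplicate-free lists.

Unique-⊆-length : {xs ys : List A} → Unique xs → xs ⊆ ys → length xs ℕ.≤ length ys
Unique-⊆-length []           _     = z≤n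
Unique-⊆-length {xs = x ∷ xs} (x∉xs ∷ uxs) xs⊆ys
  with as , bs , refl ← ∈-∃++ (xs⊆ys (here refl)) = begin
    suc (length xs)                 ≤⟨ s≤s (Unique-⊆-length uxs xs⊆as++bs) ⟩
    suc (length (as ++ bs))         ≡⟨ cong suc (length-++ as) ⟩
    suc (length as ℕ.+ length bs)   ≡⟨ sym (ℕₚ.+-suc (length as) (length bs)) ⟩
    length as ℕ.+ suc (length bs)   ≡⟨ sym (length-++ as) ⟩
    length (as ++ x ∷ bs)           ∎
  where
  open ℕₚ.≤-Reasoning
  xs⊆as++bs : xs ⊆ as ++ bs
  xs⊆as++bs z∈xs with ∈-++⁻ as (xs⊆ys (there z∈xs))
  ... | inj₁ z∈as             = ∈-++⁺ˡ z∈as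
  ... | inj₂ (here refl)      = contradiction z∈xs (All¬⇒¬Any x∉xs)
  ... | inj₂ (there z∈bs)     = ∈-++⁺ʳ as z∈bs

Unique-Fin-length : {xs : List (Fin n)} → Unique xs → length xs ℕ.≤ n
Unique-Fin-length {n} {xs} uxs =
  subst (length xs ℕ.≤_) (length-tabulate {n = n} (λ i → i)) (Unique-⊆-length uxs (λ {x} _ → ∈-allFin x))

Unique-∷⁺ : {x : A} {xs : List A} → x ∉ xs → Unique xs → Unique (x ∷ xs)
Unique-∷⁺ x∉xs uxs = ¬Any⇒All¬ _ x∉xs ∷ uxs

last-∷ : (x y : A) (zs : List A) → last (x ∷ y ∷ zs) ≡ last (y ∷ zs)
last-∷ x y zs with initLast zs
... | []      = refl
... | _ ∷ʳ′ _ = refl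

last-∷ʳ : (x : A) (ys : List A) (z : A) → last (x ∷ (ys ∷ʳ z)) ≡ z
last-∷ʳ x []       z = refl
last-∷ʳ x (y ∷ ys) z = trans (last-∷ x y (ys ∷ʳ z)) (last-∷ʳ y ys z)

last-∈ : (x : A) (ys : List A) → last (x ∷ ys) ∈ x ∷ ys
last-∈ x []       = here refl
last-∈ x (y ∷ ys) rewrite last-∷ x y ys = there (last-∈ y ys)

-- Closed predicates along linked lists.

module _ {R : Rel A 0ℓ} where

  Linked-++⁻ˡ : (xs : List A) {ys : List A} → Linked R (xs ++ ys) → Linked R xs
  Linked-++⁻ˡ []           _         = []
  Linked-++⁻ˡ (x ∷ [])     _         = [-]
  Linked-++⁻ˡ (x ∷ y ∷ xs) (r ∷ rs)  = r ∷ Linked-++⁻ˡ (y ∷ xs) rs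

  Linked-map∈ : {S : Rel A 0ℓ} {xs : List A} →
    (∀ {x y} → x ∈ xs → y ∈ xs → R x y → S x y) → Linked R xs → Linked S xs
  Linked-map∈ f []       = []
  Linked-map∈ f [-]      = [-]
  Linked-map∈ f (r ∷ rs) =
    f (here refl) (there (here refl)) r ∷ Linked-map∈ (λ x∈ y∈ → f (there x∈) (there y∈)) rs

  module _ {P : A → Set} (closed : ∀ {x y} → P x → R x y → P y) where

    Linked-forward : ∀ {x xs} → Linked R (x ∷ xs) → P x → All P (x ∷ xs)
    Linked-forward [-]      px = px ∷ []
    Linked-forward (r ∷ rs) px = px ∷ Linked-forward rs (closed px r)

    Linked-last : ∀ {z y} (xs : List A) → Linked R (xs ∷ʳ y) → z ∈ xs → P z → P y
    Linked-last (x ∷ xs) rs (here refl) pz = All.lookup (Linked-forward rs pz) (∈-++⁺ʳ (x ∷ xs) (here refl))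
    Linked-last (x ∷ x′ ∷ xs) (_ ∷ rs) (there z∈xs) pz = Linked-last (x′ ∷ xs) rs z∈xs pz

    -- The list ends in its own first element, so `P` travels from `z` forward to that closing `x`
    -- and from there through the entire cycle.
    Linked-cyclic : ∀ {z x xs} → Linked R (x ∷ xs ∷ʳ x) → z ∈ x ∷ xs → P z → All P (x ∷ xs)
    Linked-cyclic {xs = xs} rs z∈ pz =
      Linked-forward (Linked-++⁻ˡ (_ ∷ xs) rs) (Linked-last (_ ∷ xs) rs z∈ pz)

-- Walks: following a list, inserting a detour, leaving a set.

module _ {T : Rel (Fin n) 0ℓ} where

  start∈ : ∀ {x y} (w : Star T x y) → x ∈ vertices w
  start∈ ε       = here refl
  start∈ (_ ◅ _) = here refl

  walkLength-◅◅ : ∀ {x y z} (w : Star T x y) (w′ : Star T y z) →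
    walkLength (w ◅◅ w′) ≡ walkLength w ℕ.+ walkLength w′
  walkLength-◅◅ ε       w′ = refl
  walkLength-◅◅ (_ ◅ w) w′ = cong suc (walkLength-◅◅ w w′)

  ⊆-◅◅ˡ : ∀ {x y z} (w : Star T x y) (w′ : Star T y z) → vertices w ⊆ vertices (w ◅◅ w′)
  ⊆-◅◅ˡ ε       w′ (here refl) = start∈ w′
  ⊆-◅◅ˡ (_ ◅ w) w′ (here refl) = here refl
  ⊆-◅◅ˡ (_ ◅ w) w′ (there p)   = there (⊆-◅◅ˡ w w′ p)

  ⊆-◅◅ʳ : ∀ {x y z} (w : Star T x y) (w′ : Star T y z) → vertices w′ ⊆ vertices (w ◅◅ w′)
  ⊆-◅◅ʳ ε       w′ p = p
  ⊆-◅◅ʳ (_ ◅ w) w′ p = there (⊆-◅◅ʳ w w′ p)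

  alongLinked : ∀ {x z xs} → Linked T (x ∷ xs) → last (x ∷ xs) ≡ z →
    Σ[ w ∈ Star T x z ] (vertices w ≡ x ∷ xs × walkLength w ≡ length xs)
  alongLinked [-] refl = ε , refl , refl
  alongLinked {x} {xs = y ∷ ys} (r ∷ rs) last≡z
    with w , vs , len ← alongLinked rs (trans (sym (last-∷ x y ys)) last≡z)
    = r ◅ w , cong (x ∷_) vs , cong suc len

  insert : ∀ {x y z} (w : Star T x z) → y ∈ vertices w → (d : Star T y y) →
    Σ[ w′ ∈ Star T x z ] (vertices w ⊆ vertices w′ × vertices d ⊆ vertices w′
      × walkLength w′ ≡ walkLength w ℕ.+ walkLength d)
  insert ε (here refl) d = d , (λ { (here refl) → start∈ d }) , (λ p → p) , refl
  insert w@(_ ◅ _) (here refl) d =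
    d ◅◅ w , ⊆-◅◅ʳ d w , ⊆-◅◅ˡ d w ,
    trans (walkLength-◅◅ d w) (ℕₚ.+-comm (walkLength d) (walkLength w))
  insert (e ◅ w) (there p) d with w′ , w⊆ , d⊆ , len ← insert w p d =
    e ◅ w′ , (λ { (here refl) → here refl ; (there q) → there (w⊆ q) }) , there ∘ d⊆ , cong suc len

  -- With `P` the visited set, this supplies the edge along which the next detour is made.
  crossing : {P : Fin n → Set} → U.Decidable P → ∀ {x y} → Star T x y → P x → ¬ P y →
    ∃[ a ] ∃[ b ] (P a × ¬ P b × T a b)
  crossing P? ε                   px ¬py = contradiction px ¬py
  crossing P? (_◅_ {j = z} xz w)  px ¬py with P? z
  ... | yes pz = crossing P? w pz ¬py
  ... | no ¬pz = _ , z , px , ¬pz , xz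

-- Completeness of the cycle enumeration.

∈-listsOfLength : (xs : List (Fin n)) → xs ∈ listsOfLength (length xs)
∈-listsOfLength []       = here refl
∈-listsOfLength (x ∷ xs) = ∈-cartesianProductWith⁺ _∷_ (∈-allFin x) (∈-listsOfLength xs)

-- This is what lets the cycles collected along the walk be charged to `exc F`.
∈-cycles : {G : Graph n} {c : List (Fin n)} → IsCycle G c → Canonical c → c ∈ cycles G
∈-cycles {G = G} {c@(_ ∷ _)} cyc@(_ , unique , _) can =
  ∈-filter⁺ (λ c → isCycle? G c ×-dec canonical? c)
    (∈-concatMap⁺ listsOfLength
      (lose (∈-upTo⁺ (s≤s (Unique-Fin-length unique))) (∈-listsOfLength c)))
    (cyc , can)

-- Graphs with all degrees 0 or 2: their components as cycles.

module EvenGraph {n : ℕ} (F : Graph n) (degree-even : ∀ x → degree F x ≡ 0 ⊎ degree F x ≡ 2) where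

  open Graph F using (_~_; ~-sym; ~-irrefl; _~?_)

  neighbours : Fin n → List (Fin n)
  neighbours x = filter (x ~?_) (allFin n)

  ∈-neighbours : ∀ {x y} → x ~ y → y ∈ neighbours x
  ∈-neighbours {x} {y} x~y = ∈-filter⁺ (x ~?_) (∈-allFin y) x~y

  degree0⇒isolated : ∀ {x y} → degree F x ≡ 0 → ¬ x ~ y
  degree0⇒isolated {x} d x~y with neighbours x | ∈-neighbours x~y
  degree0⇒isolated () x~y | _ ∷ _ | _

  neighbour⇒degree2 : ∀ {x y} → x ~ y → degree F x ≡ 2
  neighbour⇒degree2 {x} x~y with degree-even x
  ... | inj₁ d = contradiction x~y (degree0⇒isolated d)
  ... | inj₂ d = d

  record HasNeighbours (x s t : Fin n) : Set where
    constructor mk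
    field
      adj₁ : x ~ s
      adj₂ : x ~ t
      s≢t  : s ≢ t
      only : ∀ {z} → x ~ z → z ≡ s ⊎ z ≡ t

  HasNeighbours-sym : ∀ {x s t} → HasNeighbours x s t → HasNeighbours x t s
  HasNeighbours-sym (mk s t s≢t only) = mk t s (≢-sym s≢t) ([ inj₂ , inj₁ ]′ ∘ only)

  degree2⇒neighbours : ∀ {x} → degree F x ≡ 2 → ∃[ s ] ∃[ t ] HasNeighbours x s t
  degree2⇒neighbours {x} d
    -- The list is abstracted together with the facts about it, so that they all specialise to the
    -- two-element list forced by `d`.
    with neighbours x
       | filter⁺ (x ~?_) (allFin⁺ n)
       | (λ {y} → ∈-neighbours {x} {y})
       | (λ {y} (p : y ∈ neighbours x) → proj₂ (∈-filter⁻ (x ~?_) {xs = allFin n} p))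
  degree2⇒neighbours refl | s ∷ t ∷ [] | (s≢t ∷ []) ∷ _ | ∈nb | nb∈ =
    s , t , mk (nb∈ (here refl)) (nb∈ (there (here refl))) s≢t (split ∘ ∈nb)
    where
    split : ∀ {z} → z ∈ s ∷ t ∷ [] → z ≡ s ⊎ z ≡ t
    split (here z≡s)         = inj₁ z≡s
    split (there (here z≡t)) = inj₂ z≡t

  otherNeighbour : ∀ {x s} → x ~ s → ∃[ t ] HasNeighbours x s t
  otherNeighbour x~s with degree2⇒neighbours (neighbour⇒degree2 x~s)
  ... | p , q , nb with HasNeighbours.only nb x~s
  ...   | inj₁ refl = q , nb
  ...   | inj₂ refl = p , HasNeighbours-sym nb

  Closed : (Fin n → Set) → Set
  Closed P = ∀ {x y} → P x → x ~ y → P y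

  -- `closed` makes the cycle a whole component. Prescribing its last vertex serves twice: from `u`
  -- to `v` the listing is itself a path avoiding the edge `uv`, and with the larger neighbour last
  -- it can be canonical.
  record CycleThrough (y a : Fin n) : Set where
    field
      h       : Fin n
      q       : List (Fin n)
      isCycle : IsCycle F (y ∷ h ∷ q)
      closed  : Closed (_∈ y ∷ h ∷ q)
      last≡a  : last (h ∷ q) ≡ a
      h≢a     : h ≢ a

    vs : List (Fin n)
    vs = y ∷ h ∷ q

    linked : Linked _~_ (vs ∷ʳ y)
    linked = proj₂ (proj₂ isCycle)

    unique : Unique vs
    unique = proj₁ (proj₂ isCycle)

    y~h : y ~ h
    y~h with linked
    ... | y~h ∷ _ = y~h

    h-linked : Linked _~_ (h ∷ q)
    h-linked with linked
    ... | _ ∷ rs = Linked-++⁻ˡ (h ∷ q) rs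

  -- A path h ∷ q of F from h to the neighbour a of y, grown at h; p precedes h on it
  -- (p is y when q is empty).  By nbrs′, no neighbour of h other than p
  -- lies in q, since h itself is not in y ∷ q: the growth can only end in y.
  record Path (y a h : Fin n) (q : List (Fin n)) (p : Fin n) : Set where
    constructor mk
    field
      unique : Unique (y ∷ h ∷ q)
      linked : Linked _~_ (h ∷ q ∷ʳ y)
      last≡a : last (h ∷ q) ≡ a
      p∈     : p ∈ y ∷ q
      h~p    : h ~ p
      nbrs   : ∀ {z t} → z ∈ q → z ~ t → t ∈ y ∷ h ∷ q
      nbrs′  : ∀ {z t} → z ∈ q → z ≢ p → z ~ t → t ∈ y ∷ q

  close : ∀ {y a h q p} → y ~ a → Path y a h q p → HasNeighbours h p y → CycleThrough y a
  -- With `q` empty, `p` is `y`, but closing needs two distinct neighbours of `h`; hence a closed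
  -- path has at least three vertices.
  close {q = []} y~a (mk _ _ _ (here refl) _ _ _) (mk _ _ p≢y _) = contradiction refl p≢y
  close {y} {a} {h} {q@(g ∷ q′)} y~a (mk unique linked last≡a p∈ _ nbrs _) (mk h~p h~y _ only) = record
    { h       = h
    ; q       = q
    ; isCycle = s≤s (s≤s (s≤s z≤n)) , unique , ~-sym h~y ∷ linked
    ; closed  = closed
    ; last≡a  = last≡a
    ; h≢a     = h≢a
    }
    where
    a∈q : a ∈ q
    a∈q = subst (_∈ q) (trans (sym (last-∷ h g q′)) last≡a) (last-∈ g q′)

    h≢a : h ≢ a
    h≢a = All.lookup (AllPairs.head (AllPairs.tail unique)) a∈q

    skip-h : ∀ {z} → z ∈ y ∷ q → z ∈ y ∷ h ∷ q
    skip-h (here z≡y)  = here z≡y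
    skip-h (there z∈q) = there (there z∈q)

    -- `y` has only two neighbours, `a` and one other; since `h ≢ a`, the other one is `h`.
    y-closed : ∀ {z} → y ~ z → z ∈ y ∷ h ∷ q
    y-closed y~z with otherNeighbour y~a
    ... | _ , nb with HasNeighbours.only nb (~-sym h~y)
    ...   | inj₁ h≡a = contradiction h≡a h≢a
    ...   | inj₂ refl with HasNeighbours.only nb y~z
    ...     | inj₁ refl = there (there a∈q)
    ...     | inj₂ refl = there (here refl)

    closed : Closed (_∈ y ∷ h ∷ q)
    closed (here refl) y~z = y-closed y~z
    closed (there (here refl)) h~z with only h~z
    ... | inj₁ refl = skip-h p∈
    ... | inj₂ refl = here refl
    closed (there (there z∈q)) z~t = nbrs z∈q z~t

  -- The head moves to `b` and `h` takes the role of `p`. The old `nbrs` becomes the new `nbrs′`,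
  -- and the neighbours of `h` are `p` and `b`, both listed.
  extend : ∀ {y a h q p b} → b ∉ y ∷ h ∷ q → HasNeighbours h p b → Path y a h q p →
    Path y a b (h ∷ q) h
  extend {y} {a} {h} {q} {p} {b} b∉ (mk _ h~b _ only) (mk (y∉ ∷ uniq) linked last≡a p∈ _ nbrs _) = mk
    ((≢-sym (b∉ ∘ here) ∷ y∉) ∷ Unique-∷⁺ (b∉ ∘ there) uniq)
    (~-sym h~b ∷ linked)
    (trans (last-∷ b h q) last≡a)
    (there (here refl))
    (~-sym h~b)
    nbrs-new
    λ { (here refl) h≢h _ → contradiction refl h≢h ; (there z∈q) _ z~t → nbrs z∈q z~t }
    where
    skip-b : ∀ {z} → z ∈ y ∷ h ∷ q → z ∈ y ∷ b ∷ h ∷ q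
    skip-b (here z≡y) = here z≡y
    skip-b (there z∈) = there (there z∈)

    skip-bh : ∀ {z} → z ∈ y ∷ q → z ∈ y ∷ b ∷ h ∷ q
    skip-bh (here z≡y)  = here z≡y
    skip-bh (there z∈q) = there (there (there z∈q))

    nbrs-new : ∀ {z t} → z ∈ h ∷ q → z ~ t → t ∈ y ∷ b ∷ h ∷ q
    nbrs-new (here refl) h~t with only h~t
    ... | inj₁ refl = skip-bh p∈
    ... | inj₂ refl = there (here refl)
    nbrs-new (there z∈q) z~t = skip-b (nbrs z∈q z~t)

  -- Every extension trades one unit of fuel for one more vertex. Running out of fuel would give a
  -- duplicate-free list of more than `n` vertices.
  grow : ∀ fuel {y a h q p} → n ℕ.< fuel ℕ.+ length (y ∷ h ∷ q) →
    y ~ a → Path y a h q p → CycleThrough y a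
  grow zero n< _ path =
    contradiction (Unique-Fin-length (Path.unique path)) (ℕₚ.<⇒≱ n<)
  grow (suc fuel) {y} {a} {h} {q} {p} n< y~a path@(mk (y∉ ∷ h∉ ∷ _) _ _ _ h~p _ nbrs′)
    with b , nb@(mk _ h~b p≢b _) ← otherNeighbour h~p
    with _∈?_ _≟_ b (y ∷ h ∷ q)
  ... | no b∉ = grow fuel (subst (n ℕ.<_) (sym (ℕₚ.+-suc fuel _)) n<) y~a (extend b∉ nb path)
  ... | yes (here refl) = close y~a path nb
  ... | yes (there (here refl)) = contradiction h~b (~-irrefl refl)
  ... | yes (there (there b∈q)) = contradiction (nbrs′ b∈q (≢-sym p≢b) (~-sym h~b)) h∉y∷q
    where
    h∉y∷q : h ∉ y ∷ q
    h∉y∷q (here h≡y)  = All.head y∉ (sym h≡y)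
    h∉y∷q (there h∈q) = All¬⇒¬Any h∉ h∈q

  cycleThrough : ∀ {y a} → y ~ a → CycleThrough y a
  -- The path starts as the single vertex `a`, with `p` equal to `y`.
  cycleThrough {y} {a} y~a = grow n (ℕₚ.m<m+n n (s≤s z≤n)) y~a
    (mk (Unique-∷⁺ y∉ ([] ∷ [])) (~-sym y~a ∷ [-]) refl (here refl) (~-sym y~a) (λ ()) (λ ()))
    where
    y∉ : y ∉ a ∷ []
    y∉ (here y≡a) = ~-irrefl y≡a y~a

  -- The listing by which `exc` counts the cycle of `y`; it starts at the smallest vertex, which may
  -- differ from `y`.
  record CanonicalCycle (y : Fin n) : Set where
    constructor mk
    field
      c         : List (Fin n)
      isCycle   : IsCycle F c
      canonical : Canonical c
      y∈c       : y ∈ c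
      closed    : Closed (_∈ c)

    ∈cycles : c ∈ cycles F
    ∈cycles = ∈-cycles isCycle canonical

    -- Relates the counted listing to the traversed one: both contain `y`, and the traversed vertex
    -- set is closed.
    meets⇒⊆ : {P : Fin n → Set} → Closed P → ∀ {z} → z ∈ c → P z → All P c
    meets⇒⊆ P-closed {z} z∈c pz with c | isCycle
    ... | _ ∷ _ | _ , _ , linked = Linked-cyclic P-closed linked z∈c pz

  -- Leaving y towards its larger neighbour a makes the listing of the cycle, which
  -- ends in a, canonical as soon as y is the smallest vertex of the cycle.
  canonicalCycle : ∀ {y} → degree F y ≡ 2 → CanonicalCycle y
  canonicalCycle d = go (<-wellFounded _) d
    where
    fromLarger : ∀ {y s t} → Acc Fin._<_ y → HasNeighbours y s t → s Fin.< t → CanonicalCycle y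
    go : ∀ {y} → Acc Fin._<_ y → degree F y ≡ 2 → CanonicalCycle y

    fromLarger {y} {s} {t} (acc rs) (mk _ y~t _ only) s<t
      with C ← cycleThrough y~t
      with all? (y <?_) (CycleThrough.h C ∷ CycleThrough.q C)
    ... | yes y<all = mk vs isCycle (y<all , h<last) (here refl) closed
      where
      open CycleThrough C
      -- `h` is the neighbour of `y` other than the last vertex `t`, so it is the smaller one, `s`.
      h<last : h Fin.< last (h ∷ q)
      h<last with only y~h
      ... | inj₁ h≡s = subst (Fin._< last (h ∷ q)) (sym h≡s) (subst (s Fin.<_) (sym last≡a) s<t)
      ... | inj₂ h≡t = contradiction h≡t h≢a
    -- A vertex `z` of the cycle below `y` restarts the search from `z`; closedness of the cycle
    -- found there brings `y` back into it.
    ... | no ¬y<all = mk (c C′) (isCycle C′) (canonical C′) y∈C′ (closed C′)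
      where
      open CycleThrough C hiding (isCycle; closed)
      open CanonicalCycle using (c; isCycle; canonical; y∈c; closed)
      smaller : ∃[ z ] (z ∈ h ∷ q × ¬ y Fin.< z)
      smaller = find (¬All⇒Any¬ (y <?_) _ ¬y<all)
      z : Fin n
      z = proj₁ smaller
      z∈ : z ∈ h ∷ q
      z∈ = proj₁ (proj₂ smaller)
      z<y : z Fin.< y
      z<y with Finₚ.<-cmp z y
      ... | tri< z<y _ _ = z<y
      ... | tri≈ _ z≡y _ = contradiction (sym z≡y) (All.lookup (AllPairs.head unique) z∈)
      ... | tri> _ _ y<z = contradiction y<z (proj₂ (proj₂ smaller))
      -- If `z` were isolated, being equal to `z` would be a closed property, and following the
      -- listing from `z` to its end `y` would give `y ≡ z`.
      deg-z : degree F z ≡ 2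
      deg-z with degree-even z
      ... | inj₂ d = d
      ... | inj₁ d = contradiction (sym y≡z) (Finₚ.<⇒≢ z<y)
        where
        y≡z : y ≡ z
        y≡z = Linked-last {P = _≡ z} (λ { refl z~t → contradiction z~t (degree0⇒isolated d) })
                vs linked (there z∈) refl
      C′ : CanonicalCycle z
      C′ = go (rs z<y) deg-z
      y∈C′ : y ∈ c C′
      y∈C′ = Linked-last (closed C′) vs linked (there z∈) (y∈c C′)

    go {y} ac d with degree2⇒neighbours d
    ... | s , t , nb with Finₚ.<-cmp s t
    ...   | tri< s<t _ _ = fromLarger ac nb s<t
    ...   | tri≈ _ s≡t _ = contradiction s≡t (HasNeighbours.s≢t nb)
    ...   | tri> _ _ t<s = fromLarger ac (HasNeighbours-sym nb) t<s

-- Building the covering walk component by component.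

module Covering {n : ℕ} (G : Graph n) (u v : Fin n) (connected : Connected (deleteEdge G u v))
                (F : Graph n) (through : IsEvenCoverThrough G u v F) where

  open IsEvenCover (proj₁ through)
  open EvenGraph F degree-even
  open Graph F using (_~_; ~-sym; ~-irrefl)

  H : Graph n
  H = deleteEdge G u v

  u~v : u ~ v
  u~v = proj₂ through

  -- In either orientation the deleted edge has `u` as an endpoint.
  inH : ∀ {x y} → x ≢ u → y ≢ u → x ~ y → Adj H x y
  inH x≢u y≢u x~y = subgraph x~y , [ x≢u ∘ proj₁ , y≢u ∘ proj₂ ]′

  -- The set vs is a union of components of F.  In the bound, each cycle in cs pays 2
  -- and each isolated vertex in is pays 1 for its detour, besides its vertices.
  record PartialWalk : Set where
    field
      w        : Walk H u v
      vs       : List (Fin n)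
      cs       : List (List (Fin n))
      is       : List (Fin n)
      vs⊆w     : vs ⊆ vertices w
      u∈vs     : u ∈ vs
      closed   : Closed (_∈ vs)
      unique   : Unique vs
      uniqueᶜ  : Unique cs
      uniqueⁱ  : Unique is
      cs⊆      : cs ⊆ cycles F
      is⊆      : is ⊆ isolatedVertices F
      cs-in-vs : ∀ {c} → c ∈ cs → c ⊆ vs
      is-in-vs : is ⊆ vs
      bound    : walkLength w ℕ.+ 3 ℕ.≤ length vs ℕ.+ (2 ℕ.* length cs ℕ.+ length is)

    unvisited-closed : Closed (_∉ vs)
    unvisited-closed x∉ x~y y∈ = x∉ (closed y∈ (~-sym x~y))

  start : PartialWalk
  start = record
    { w        = w
    ; vs       = vs
    ; cs       = [ c ]
    ; is       = []
    ; vs⊆w     = λ {z} → subst (z ∈_) (sym vertices-w)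
    ; u∈vs     = here refl
    ; closed   = closed
    ; unique   = unique
    ; uniqueᶜ  = [] ∷ []
    ; uniqueⁱ  = []
    ; cs⊆      = λ { (here refl) → ∈cycles }
    ; is⊆      = λ ()
    ; cs-in-vs = λ { (here refl) → All.lookup (meets⇒⊆ closed y∈c (here refl)) }
    ; is-in-vs = λ ()
    -- Equality at the start: the path is one shorter than its vertex count, and the single cycle
    -- pays 2.
    ; bound    = ℕₚ.≤-reflexive (trans (cong (ℕ._+ 3) length-w) (arith (length q)))
    }
    where
    open CycleThrough (cycleThrough u~v)
    open CanonicalCycle (canonicalCycle (neighbour⇒degree2 u~v)) using (c; ∈cycles; y∈c; meets⇒⊆)

    ≢u : ∀ {x} → x ∈ h ∷ q → x ≢ u
    ≢u x∈ x≡u = All.lookup (AllPairs.head unique) x∈ (sym x≡u)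

    linkedᴴ : Linked (Adj H) (u ∷ h ∷ q)
    linkedᴴ =
      -- Only this first edge touches `u`; it survives the deletion because `h` is not `v`.
      (subgraph y~h , [ h≢a ∘ proj₂ , (λ (u≡v , _) → ~-irrefl u≡v u~v) ]′)
      ∷ Linked-map∈ (λ x∈ y∈ → inH (≢u x∈) (≢u y∈)) h-linked

    along : Σ[ w ∈ Walk H u v ] (vertices w ≡ vs × walkLength w ≡ length (h ∷ q))
    along = alongLinked linkedᴴ (trans (last-∷ u h q) last≡a)

    w : Walk H u v
    w = proj₁ along

    vertices-w : vertices w ≡ vs
    vertices-w = proj₁ (proj₂ along)

    length-w : walkLength w ≡ length (h ∷ q)
    length-w = proj₂ (proj₂ along)

    arith : ∀ k → suc k ℕ.+ 3 ≡ suc (suc k) ℕ.+ (2 ℕ.* 1 ℕ.+ 0)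
    arith = solve-∀

  module _ (S : PartialWalk) {x y} (x∈vs : x ∈ PartialWalk.vs S) (y∉vs : y ∉ PartialWalk.vs S)
           (xy : Adj H x y) where

    open PartialWalk S

    detour : (d : Walk H y y) →
      Σ[ w′ ∈ Walk H u v ] (vertices w ⊆ vertices w′ × vertices d ⊆ vertices w′
        × walkLength w′ ≡ walkLength w ℕ.+ (2 ℕ.+ walkLength d))
    detour d with insert w (vs⊆w x∈vs) (xy ◅ d ◅◅ (Graph.~-sym H xy ◅ ε))
    ... | w′ , w⊆ , d⊆ , len = w′ , w⊆ , d⊆ ∘ there ∘ ⊆-◅◅ˡ d _ ,
      trans len (cong (λ k → walkLength w ℕ.+ suc k)
        (trans (walkLength-◅◅ d _) (ℕₚ.+-comm (walkLength d) 1)))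

    -- The detour costs 2, paid by `y` as a new vertex of `vs` and as a new member of `is`.
    addIsolated : degree F y ≡ 0 → Σ[ S′ ∈ PartialWalk ] (length vs ℕ.< length (PartialWalk.vs S′))
    addIsolated d with detour ε
    ... | w′ , w⊆ , y⊆ , len = record
      { w        = w′
      ; vs       = y ∷ vs
      ; cs       = cs
      ; is       = y ∷ is
      ; vs⊆w     = λ { (here refl) → y⊆ (here refl) ; (there z∈) → w⊆ (vs⊆w z∈) }
      ; u∈vs     = there u∈vs
      ; closed   = λ { (here refl) y~t → contradiction y~t (degree0⇒isolated d)
                     ; (there z∈) z~t → there (closed z∈ z~t) }
      ; unique   = Unique-∷⁺ y∉vs unique
      ; uniqueᶜ  = uniqueᶜ
      ; uniqueⁱ  = Unique-∷⁺ (y∉vs ∘ is-in-vs) uniqueⁱ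
      ; cs⊆      = cs⊆
      ; is⊆      = λ { (here refl) → ∈-filter⁺ (λ z → degree F z ℕₚ.≟ 0) (∈-allFin y) d
                     ; (there z∈) → is⊆ z∈ }
      ; cs-in-vs = λ c∈ z∈ → there (cs-in-vs c∈ z∈)
      ; is-in-vs = λ { (here refl) → here refl ; (there z∈) → there (is-in-vs z∈) }
      ; bound    = begin
          walkLength w′ ℕ.+ 3                   ≡⟨ cong (ℕ._+ 3) len ⟩
          walkLength w ℕ.+ 2 ℕ.+ 3              ≡⟨ arith₁ (walkLength w) ⟩
          2 ℕ.+ (walkLength w ℕ.+ 3)            ≤⟨ ℕₚ.+-monoʳ-≤ 2 bound ⟩
          2 ℕ.+ (length vs ℕ.+ (2 ℕ.* length cs ℕ.+ length is))
            ≡⟨ arith₂ (length vs) (length cs) (length is) ⟩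
          suc (length vs) ℕ.+ (2 ℕ.* length cs ℕ.+ suc (length is)) ∎
      } , ℕₚ.≤-refl
      where
      open ℕₚ.≤-Reasoning
      arith₁ : ∀ k → k ℕ.+ 2 ℕ.+ 3 ≡ 2 ℕ.+ (k ℕ.+ 3)
      arith₁ = solve-∀
      arith₂ : ∀ a b c → 2 ℕ.+ (a ℕ.+ (2 ℕ.* b ℕ.+ c)) ≡ suc a ℕ.+ (2 ℕ.* b ℕ.+ suc c)
      arith₂ = solve-∀

    -- Going once around the cycle costs its number of vertices, paid by the new entries of `vs`;
    -- the 2 for crossing `xy` both ways is paid by the new cycle.
    addCycle : ∀ {a} → y ~ a → Σ[ S′ ∈ PartialWalk ] (length vs ℕ.< length (PartialWalk.vs S′))
    addCycle {a} y~a = record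
      { w        = w′
      ; vs       = D.vs ++ vs
      ; cs       = c ∷ cs
      ; is       = is
      ; vs⊆w     = [ d⊆ ∘ subst (_ ∈_) (sym vertices-d) ∘ ∈-++⁺ˡ , w⊆ ∘ vs⊆w ]′ ∘ ∈-++⁻ D.vs
      ; u∈vs     = ∈-++⁺ʳ D.vs u∈vs
      ; closed   = λ z∈ z~t → [ (λ z∈D → ∈-++⁺ˡ (D.closed z∈D z~t))
                              , (λ z∈vs → ∈-++⁺ʳ D.vs (closed z∈vs z~t)) ]′ (∈-++⁻ D.vs z∈)
      ; unique   = ++⁺ D.unique unique (λ (z∈D , z∈vs) → D∉vs z∈D z∈vs)
      -- The cycle is new because it contains the unvisited `y`, while those in `cs` lie inside
      -- `vs`.
      ; uniqueᶜ  = Unique-∷⁺ (λ c∈cs → y∉vs (cs-in-vs c∈cs y∈c)) uniqueᶜ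
      ; uniqueⁱ  = uniqueⁱ
      ; cs⊆      = λ { (here refl) → ∈cycles ; (there c∈) → cs⊆ c∈ }
      ; is⊆      = is⊆
      ; cs-in-vs = λ { (here refl) z∈ → ∈-++⁺ˡ (All.lookup (meets⇒⊆ D.closed y∈c (here refl)) z∈)
                     ; (there c∈) z∈ → ∈-++⁺ʳ D.vs (cs-in-vs c∈ z∈) }
      ; is-in-vs = λ z∈ → ∈-++⁺ʳ D.vs (is-in-vs z∈)
      ; bound    = begin
          walkLength w′ ℕ.+ 3                             ≡⟨ cong (ℕ._+ 3) len ⟩
          walkLength w ℕ.+ (2 ℕ.+ walkLength d) ℕ.+ 3
            ≡⟨ cong (λ k → walkLength w ℕ.+ (2 ℕ.+ k) ℕ.+ 3) length-d ⟩
          walkLength w ℕ.+ (2 ℕ.+ length D.vs) ℕ.+ 3      ≡⟨ arith₁ (walkLength w) (length D.vs) ⟩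
          length D.vs ℕ.+ 2 ℕ.+ (walkLength w ℕ.+ 3)      ≤⟨ ℕₚ.+-monoʳ-≤ (length D.vs ℕ.+ 2) bound ⟩
          length D.vs ℕ.+ 2 ℕ.+ (length vs ℕ.+ (2 ℕ.* length cs ℕ.+ length is))
            ≡⟨ arith₂ (length D.vs) (length vs) (length cs) (length is) ⟩
          length D.vs ℕ.+ length vs ℕ.+ (2 ℕ.* suc (length cs) ℕ.+ length is)
            ≡⟨ cong (ℕ._+ (2 ℕ.* suc (length cs) ℕ.+ length is)) (sym (length-++ D.vs)) ⟩
          length (D.vs ++ vs) ℕ.+ (2 ℕ.* suc (length cs) ℕ.+ length is) ∎
      } , subst (length vs ℕ.<_) (sym (length-++ D.vs)) (ℕₚ.m<n+m (length vs) (s≤s z≤n))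
      where
      open ℕₚ.≤-Reasoning
      module D = CycleThrough (cycleThrough y~a)
      open CanonicalCycle (canonicalCycle (neighbour⇒degree2 y~a)) using (c; ∈cycles; y∈c; meets⇒⊆)

      -- The complement of `vs` is closed as well, so the whole cycle is unvisited. In particular it
      -- misses `u`, and all its edges survive in `H`.
      D∉vs : ∀ {z} → z ∈ D.vs → z ∉ vs
      D∉vs = All.lookup (Linked-cyclic unvisited-closed D.linked (here refl) y∉vs)

      D∷ʳ≢u : ∀ {z} → z ∈ D.vs ∷ʳ y → z ≢ u
      D∷ʳ≢u z∈ refl = [ (λ u∈D → D∉vs u∈D u∈vs) , (λ { (here refl) → y∉vs u∈vs }) ]′ (∈-++⁻ D.vs z∈)

      along : Σ[ d ∈ Walk H y y ] (vertices d ≡ D.vs ∷ʳ y × walkLength d ≡ length ((D.h ∷ D.q) ∷ʳ y))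
      along = alongLinked (Linked-map∈ (λ x∈ y∈ → inH (D∷ʳ≢u x∈) (D∷ʳ≢u y∈)) D.linked)
                          (last-∷ʳ y (D.h ∷ D.q) y)

      d : Walk H y y
      d = proj₁ along

      vertices-d : vertices d ≡ D.vs ∷ʳ y
      vertices-d = proj₁ (proj₂ along)

      length-d : walkLength d ≡ length D.vs
      length-d = trans (proj₂ (proj₂ along))
        (trans (length-++ (D.h ∷ D.q)) (ℕₚ.+-comm (length (D.h ∷ D.q)) 1))

      w′ : Walk H u v
      w′ = proj₁ (detour d)

      w⊆ : vertices w ⊆ vertices w′
      w⊆ = proj₁ (proj₂ (detour d))

      d⊆ : vertices d ⊆ vertices w′
      d⊆ = proj₁ (proj₂ (proj₂ (detour d)))

      len : walkLength w′ ≡ walkLength w ℕ.+ (2 ℕ.+ walkLength d)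
      len = proj₂ (proj₂ (proj₂ (detour d)))

      arith₁ : ∀ k l → k ℕ.+ (2 ℕ.+ l) ℕ.+ 3 ≡ l ℕ.+ 2 ℕ.+ (k ℕ.+ 3)
      arith₁ = solve-∀
      arith₂ : ∀ l a b c → l ℕ.+ 2 ℕ.+ (a ℕ.+ (2 ℕ.* b ℕ.+ c)) ≡ l ℕ.+ a ℕ.+ (2 ℕ.* suc b ℕ.+ c)
      arith₂ = solve-∀

    addComponent : Σ[ S′ ∈ PartialWalk ] (length vs ℕ.< length (PartialWalk.vs S′))
    addComponent with degree-even y
    ... | inj₁ d = addIsolated d
    ... | inj₂ d = addCycle (HasNeighbours.adj₁ (proj₂ (proj₂ (degree2⇒neighbours d))))

  complete : ∀ fuel (S : PartialWalk) → n ℕ.≤ fuel ℕ.+ length (PartialWalk.vs S) →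
    Σ[ w ∈ Walk H u v ] (VisitsAll w × walkLength w ℕ.+ 3 ℕ.≤ n ℕ.+ exc F)
  complete fuel S n≤ with Finₚ.all? (λ z → _∈?_ _≟_ z (PartialWalk.vs S))
  -- The three lists are duplicate-free, so their lengths are at most `n` and the two counts in
  -- `exc F`.
  ... | yes all∈ = w , (λ z → vs⊆w (all∈ z)) , ℕₚ.≤-trans bound
        (ℕₚ.+-mono-≤ (Unique-Fin-length unique)
          (ℕₚ.+-mono-≤ (ℕₚ.*-monoʳ-≤ 2 (Unique-⊆-length uniqueᶜ cs⊆)) (Unique-⊆-length uniqueⁱ is⊆)))
    where open PartialWalk S
  complete fuel S n≤ | no ¬all∈ with Finₚ.¬∀⟶∃¬ n _ (λ z → _∈?_ _≟_ z (PartialWalk.vs S)) ¬all∈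
  -- Without fuel `vs` already has `n` vertices, leaving no room for `z`.
  complete zero S n≤ | no _ | z , z∉ =
    contradiction (Unique-Fin-length (Unique-∷⁺ z∉ (PartialWalk.unique S))) (ℕₚ.≤⇒≯ n≤)
  complete (suc fuel) S n≤ | no _ | z , z∉
    with x , y , x∈ , y∉ , xy ←
      crossing (λ z → _∈?_ _≟_ z (PartialWalk.vs S)) (connected u z) (PartialWalk.u∈vs S) z∉
    with S′ , larger ← addComponent S x∈ y∉ xy =
    complete fuel S′ (ℕₚ.≤-trans n≤
      (ℕₚ.≤-trans (ℕₚ.≤-reflexive (sym (ℕₚ.+-suc fuel _))) (ℕₚ.+-monoʳ-≤ fuel larger)))

  coveringWalk : Σ[ w ∈ Walk H u v ] (VisitsAll w × walkLength w ℕ.+ 3 ℕ.≤ n ℕ.+ exc F)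
  coveringWalk = complete n start (ℕₚ.m≤m+n n _)

-- Existence of the optimum by decidable search.

walkOfLength? : (H : Graph n) {P : List (Fin n) → Set} → U.Decidable P → ∀ x y k →
  Dec (Σ[ w ∈ Walk H x y ] (P (vertices w) × walkLength w ≡ k))
walkOfLength? H P? x y zero with x ≟ y
... | no x≢y = no λ { (ε , _) → x≢y refl ; (_ ◅ _ , _ , ()) }
... | yes refl with P? (x ∷ [])
...   | yes p = yes (ε , p , refl)
...   | no ¬p = no λ { (ε , p , _) → ¬p p ; (_ ◅ _ , _ , ()) }
-- `P` is arbitrary so that the recursion can pass to the rest of the walk with `x` already recorded
-- as visited.
walkOfLength? H P? x y (suc k)
  with any? (λ z → Adj? H x z ×-dec walkOfLength? H (P? ∘ (x ∷_)) z y k)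
... | yes (z , xz , w , p , len) = yes (xz ◅ w , p , cong suc len)
... | no ¬∃ = no λ { (ε , _ , ()) ; (xz ◅ w , p , len) → ¬∃ (_ , xz , w , p , ℕₚ.suc-injective len) }

-- Any witness below `k` replaces `k`; the descent is well-founded and stops at a minimum.
minimum≤ : {P : ℕ → Set} → U.Decidable P → ∀ {k} → P k → ∃[ m ] (IsMinimum P m × m ℕ.≤ k)
minimum≤ {P} P? = go (ℕ-<-wellFounded _)
  where
  go : ∀ {k} → Acc ℕ._<_ k → P k → ∃[ m ] (IsMinimum P m × m ℕ.≤ k)
  go {k} (acc rs) pk with ℕₚ.anyUpTo? P? k
  ... | yes (j , j<k , pj) = map₂ (map₂ (λ m≤j → ℕₚ.≤-trans m≤j (ℕₚ.<⇒≤ j<k))) (go (rs j<k) pj)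
  ... | no ¬∃ = k , (pk , λ j pj → ℕₚ.≮⇒≥ (λ j<k → ¬∃ (j , j<k , pj))) , ℕₚ.≤-refl

OPT≤ : (H : Graph n) {u v : Fin n} (w : Walk H u v) → VisitsAll w →
  ∃[ o ] (IsOPT H u v o × o ℕ.≤ walkLength w)
OPT≤ H w all = minimum≤
  (walkOfLength? H (λ xs → Finₚ.all? (λ z → _∈?_ _≟_ z xs)) _ _) (w , all , refl)

-- Passage to the integers and the theorem.

+3≤⇒≤-3 : ∀ {a} {b : ℤ} → + (a ℕ.+ 3) ≤ b → + a ≤ b - + 3
+3≤⇒≤-3 {a} a+3≤b = subst (_≤ _) (cancel (+ a)) (ℤₚ.+-monoˡ-≤ (ℤ.- + 3) a+3≤b)
  where
  cancel : ∀ i → i + + 3 - + 3 ≡ i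
  cancel = ℤ-solve-∀

lemma7 : ∀ (n : ℕ) (G : Graph n) → Subcubic G →
    ∀ (u v : Fin n) → Adj G u v → Connected (deleteEdge G u v) →
    (∀ (F : Graph n) → IsEvenCoverThrough G u v F →
    Σ[ w ∈ Walk (deleteEdge G u v) u v ] (VisitsAll w
    × + walkLength w ≤ + n + + exc F - + 3))
    × (∀ (x : ℤ) → IsExcₑ G u v x →
    ∃[ o ] (IsOPT (deleteEdge G u v) u v o × + o ≤ + n + x - + 1))
lemma7 n G _ u v _ connected = walk , opt
  where
  walk : ∀ (F : Graph n) → IsEvenCoverThrough G u v F →
    Σ[ w ∈ Walk (deleteEdge G u v) u v ] (VisitsAll w × + walkLength w ≤ + n + + exc F - + 3)
  walk F through with w , all , len ← Covering.coveringWalk G u v connected F through =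
    w , all , +3≤⇒≤-3 (ℤ.+≤+ len)

  regroup : ∀ i j → i + j - + 3 ≡ i + (j - + 2) - + 1
  regroup = ℤ-solve-∀

  opt : ∀ (x : ℤ) → IsExcₑ G u v x →
    ∃[ o ] (IsOPT (deleteEdge G u v) u v o × + o ≤ + n + x - + 1)
  -- The minimum behind `x` is attained by some `F`, so `x` is `exc F - 2`, and the bound for this
  -- `F` regroups as `n + x - 1`.
  opt _ (_ , ((F , through , refl) , _) , refl)
    with w , all , len ← walk F through
    with o , isOPT , o≤ ← OPT≤ (deleteEdge G u v) w all =
    o , isOPT , ℤₚ.≤-trans (ℤ.+≤+ o≤) (subst (+ walkLength w ≤_) (regroup (+ n) (+ exc F)) len)
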